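{- There exists a string family on which $\ell_p = \Omega(\ell_m\sqrt{n})$, where $n$ is the length of the string.
   Context: A string family is an infinite set of finite strings of unbounded length; asymptotic notation on a family refers to strings $w$ of the family with $n=|w|\to\infty$ (with constants uniform over the family). $w[i:j]$ denotes the substring of $w$ from position $i$ to position $j$ (positions start at 1). L-systems: an L-system is a tuple $(\Sigma,\varphi,\tau,s,d,n)$, where $\Sigma$ is a finite alphabet, $\varphi:\Sigma^*\to\Sigma^*$ is a non-erasing monoid endomorphism (each rule $a\to\varphi(a)$, $a\in\Sigma$, has $|\varphi(a)|\ge 1$), $\tau:\Sigma^*\to\Sigma^*$ is a coding (a morphism with $|\tau(a)|=1$ for all $a\in\Sigma$), $s\in\Sigma^+$ is the axiom, and $d\ge 0$, $n\ge 1$ are integers. It generates the unique string $\tau(\varphi^d(s))[1:n]$ of length $n$. It is always assumed that $d=n^{O(1)}$ and $|\Sigma|=n^{O(1)}$ (each value fits in an $O(\log n)$-bit word). The size of the L-system is $\sum_{a\in\Sigma}|\varphi(a)|+|s|+|\Sigma|+2$. An L-system is prolongable if there is a symbol $a$ such that $s=a$ and $\varphi(a)=ax$ with $x\neq\varepsilon$ (the empty string). $\ell_m(w)$ is the size of the smallest prolongable L-system generating $w$. $\ell_p(w)$ is the size of the smallest prolongable L-system generating $w$ whose coding $\tau$ is the identity function. -}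

module Defs where

open import Data.List.Base using (List; []; _∷_; _++_; [_]; length; map; concatMap; sum; take; deduplicate)
open import Data.List.Membership.Propositional using (_∈_)
open import Data.List.Membership.Propositional.Properties using (∈-deduplicate⁺)
open import Data.List.Properties using (length-deduplicate; map-id; ++-identityʳ)
open import Data.List.Relation.Unary.All using (All; []; _∷_; tabulate)
open import Data.List.Relation.Unary.All.Properties using (++⁺)
open import Data.List.Relation.Unary.Any using (here)
open import Data.List.Relation.Unary.Unique.Propositional using (Unique)
open import Data.List.Relation.Unary.Unique.DecPropositional.Properties using (deduplicate-!)
open import Data.Nat.Base using (ℕ; suc; _+_; _^_; _≤_; _<_; z≤n; s≤s; NonZero)
open import Data.Nat.GeneralisedArithmetic using (fold)
open import Data.Nat.Induction using (<-rec)
open import Data.Nat.Properties using (_≟_; ≤-trans; ≮⇒≥; m≤m*n; m^n≢0)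
open import Data.Product.Base using (∃; ∃-syntax; _×_; _,_; proj₁; proj₂)
open import Relation.Binary.PropositionalEquality using (_≡_; _≢_; refl; trans; cong)
open import Relation.Nullary using (¬_; yes; no; contradiction)

-- ℕ is the universe from which the finite alphabets are drawn.
Word : Set
Word = List ℕ

-- The rules and the coding are total functions, but only their values on
-- the alphabet Σ matter: the closure conditions keep everything inside Σ.
record LSystem : Set where
  field
    Σ            : List ℕ
    Σ-unique     : Unique Σ
    φ            : ℕ → Word
    φ-closed     : ∀ {a} → a ∈ Σ → All (_∈ Σ) (φ a)
    φ-nonerasing : ∀ {a} → a ∈ Σ → 1 ≤ length (φ a)
    τ            : ℕ → ℕ
    τ-closed     : ∀ {a} → a ∈ Σ → τ a ∈ Σ
    s            : Word
    s-closed     : All (_∈ Σ) s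
    s-nonempty   : s ≢ []
    d            : ℕ
    n            : ℕ
    n-positive   : 1 ≤ n

open LSystem

-- φ^d(s)
derive : LSystem → Word
derive L = fold (s L) (concatMap (φ L)) (d L)

-- The length condition makes τ(φ^d(s)) have at least n letters, so that
-- the prefix [1:n] exists.
Generates : LSystem → Word → Set
Generates L w = length w ≡ n L × take (n L) (map (τ L) (derive L)) ≡ w

size : LSystem → ℕ
size L = sum (map (λ a → length (φ L a)) (Σ L)) + length (s L) + length (Σ L) + 2

-- The standing assumption d, |Σ| = n^O(1), with the exponent explicit.
PolyBounded : ℕ → LSystem → Set
PolyBounded K L = d L ≤ n L ^ K × length (Σ L) ≤ n L ^ K

Prolongable : LSystem → Set
Prolongable L = ∃[ a ] ∃[ x ] (s L ≡ [ a ] × φ L a ≡ a ∷ x × x ≢ [])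

IdentityCoding : LSystem → Set
IdentityCoding L = ∀ {a} → a ∈ Σ L → τ L a ≡ a

IsSmallestSize : (LSystem → Set) → ℕ → Set
IsSmallestSize P k = (∃[ L ] (P L × size L ≡ k)) × (∀ L → P L → k ≤ size L)

ProlongableFor : ℕ → Word → LSystem → Set
ProlongableFor K w L = PolyBounded K L × Prolongable L × Generates L w

PureProlongableFor : ℕ → Word → LSystem → Set
PureProlongableFor K w L = ProlongableFor K w L × IdentityCoding L

-- ℓₘ[ K ] w ≔ k reads "ℓₘ(w) = k", with K the exponent in PolyBounded.
ℓₘ[_]_≔_ : ℕ → Word → ℕ → Set
ℓₘ[ K ] w ≔ k = IsSmallestSize (ProlongableFor K w) k

ℓₚ[_]_≔_ : ℕ → Word → ℕ → Set
ℓₚ[ K ] w ≔ k = IsSmallestSize (PureProlongableFor K w) k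

-- A set of strings of unbounded length is in particular infinite.
IsStringFamily : (Word → Set) → Set
IsStringFamily F = ∀ N → ∃[ w ] (F w × N ≤ length w)

-- ℓₘ and ℓₚ are relations because no minimum is computed here.  They have
-- (classically) a value at every nonempty word, thanks to the one-step
-- system below.  The values are unique by antisymmetry of _≤_.

private
  take-length-++ : ∀ (u v : Word) → take (length u) (u ++ v) ≡ u
  take-length-++ []      v = refl
  take-length-++ (x ∷ u) v = cong (x ∷_) (take-length-++ u v)

  1≤1+m^K : ∀ m K → 1 ≤ suc m ^ K
  1≤1+m^K m K with suc m ^ K | m^n≢0 (suc m) K
  ... | suc _ | _ = s≤s z≤n

  m≤m^K : ∀ m K → .{{NonZero K}} → suc m ≤ suc m ^ K
  m≤m^K m (suc K) = m≤m*n (suc m) (suc m ^ K) {{m^n≢0 (suc m) K}}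

  last-nonempty : ∀ (u : Word) {b} → u ++ [ b ] ≢ []
  last-nonempty []      ()
  last-nonempty (_ ∷ _) ()

module _ (a : ℕ) (u : Word) where

  private
    w : Word
    w = a ∷ u

    alphabet : List ℕ
    alphabet = deduplicate _≟_ w

    a∈ : a ∈ alphabet
    a∈ = ∈-deduplicate⁺ _≟_ {xs = w} (here refl)

    rule : ℕ → Word
    rule b with b ≟ a
    ... | yes _ = w ++ [ a ]
    ... | no  _ = [ b ]

    rule-a : rule a ≡ w ++ [ a ]
    rule-a with a ≟ a
    ... | yes _   = refl
    ... | no  a≢a = contradiction refl a≢a

    rule-closed : ∀ {b} → b ∈ alphabet → All (_∈ alphabet) (rule b)
    rule-closed {b} b∈ with b ≟ a
    ... | yes _ = ++⁺ (tabulate (∈-deduplicate⁺ _≟_ {xs = w})) (a∈ ∷ [])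
    ... | no  _ = b∈ ∷ []

    rule-nonerasing : ∀ b → 1 ≤ length (rule b)
    rule-nonerasing b with b ≟ a
    ... | yes _ = s≤s z≤n
    ... | no  _ = s≤s z≤n

  oneStep : LSystem
  oneStep = record
    { Σ            = alphabet
    ; Σ-unique     = deduplicate-! _≟_ w
    ; φ            = rule
    ; φ-closed     = rule-closed
    ; φ-nonerasing = λ {b} _ → rule-nonerasing b
    ; τ            = λ b → b
    ; τ-closed     = λ b∈ → b∈
    ; s            = [ a ]
    ; s-closed     = a∈ ∷ []
    ; s-nonempty   = λ ()
    ; d            = 1
    ; n            = length w
    ; n-positive   = s≤s z≤n
    }

  oneStep-generates : Generates oneStep w
  oneStep-generates = refl , trans (cong (take (length w)) eq) (take-length-++ w [ a ])
    where
    eq : map (λ b → b) (rule a ++ []) ≡ w ++ [ a ]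
    eq = trans (map-id _) (trans (++-identityʳ (rule a)) rule-a)

  oneStep-pure : ∀ K → .{{NonZero K}} → PureProlongableFor K w oneStep
  oneStep-pure K =
    ( (1≤1+m^K (length u) K , ≤-trans (length-deduplicate _≟_ w) (m≤m^K (length u) K))
    , (a , u ++ [ a ] , refl , rule-a , last-nonempty u)
    , oneStep-generates
    ) , λ _ → refl

smallest-exists : ∀ {P : LSystem → Set} → ∃ P → ¬ ¬ ∃ (IsSmallestSize P)
smallest-exists {P} (L₀ , p₀) none =
  <-rec (λ k → ∀ L → P L → size L ≢ k) step (size L₀) L₀ p₀ refl
  where
  step : ∀ k → (∀ {j} → j < k → ∀ L → P L → size L ≢ j) → ∀ L → P L → size L ≢ k
  step k below L p eq =
    none (k , (L , p , eq) , λ M q → ≮⇒≥ (λ lt → below lt M q refl))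

ℓₘ-defined : ∀ K → .{{NonZero K}} → ∀ w → w ≢ [] → ¬ ¬ (∃[ k ] (ℓₘ[ K ] w ≔ k))
ℓₘ-defined K []      w≢[] = contradiction refl w≢[]
ℓₘ-defined K (a ∷ u) _    = smallest-exists (oneStep a u , proj₁ (oneStep-pure a u K))

ℓₚ-defined : ∀ K → .{{NonZero K}} → ∀ w → w ≢ [] → ¬ ¬ (∃[ k ] (ℓₚ[ K ] w ≔ k))
ℓₚ-defined K []      w≢[] = contradiction refl w≢[]
ℓₚ-defined K (a ∷ u) _    = smallest-exists (oneStep a u , oneStep-pure a u K)

{-# OPTIONS --safe #-}

-- The family is 0 0 1ᵏ.  With a coding, a second letter 2 that is coded as 0
-- lets a system of constant size tell the two initial 0s apart.  Without one,
-- φ(0) = 0 x must start with 0 0, so φ²(0) starts with φ(0) 0: a third 0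
-- occurs right after φ(0), and hence φ(0) is as long as the whole string.
-- This gives ℓₚ ≥ n with ℓₘ bounded.
module Submission where

open import Defs
open import Data.List.Base using (List; []; _∷_; _++_; [_]; length; map; concatMap; take; replicate)
open import Data.List.Membership.Propositional using (_∈_)
open import Data.List.Properties using (length-replicate; length-take; map-replicate; map-id-local; ++-identityʳ; ∷-injective; ∷-injectiveˡ; take-all)
open import Data.List.Relation.Unary.All as All using (All; []; _∷_)
open import Data.List.Relation.Unary.All.Properties using (concat⁺; map⁺)
open import Data.List.Relation.Unary.AllPairs using ([]; _∷_)
open import Data.List.Relation.Unary.Any using (here; there)
open import Data.Nat.Base using (ℕ; zero; suc; _+_; _*_; _^_; _≤_; z≤n; s≤s; NonZero; >-nonZero)
open import Data.Nat.GeneralisedArithmetic using (fold)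
open import Data.Nat.ListAction using (sum)
open import Data.Nat.Properties
open import Data.Product.Base using (∃-syntax; _×_; _,_; proj₂)
open import Relation.Binary.PropositionalEquality using (_≡_; _≢_; refl; sym; trans; cong; subst)
open import Relation.Nullary using (contradiction)

open LSystem

private
  variable
    A : Set

  ∈⇒≤-sum-map : ∀ (f : A → ℕ) {x xs} → x ∈ xs → f x ≤ sum (map f xs)
  ∈⇒≤-sum-map f (here refl) = m≤m+n _ _
  ∈⇒≤-sum-map f (there x∈)  = ≤-trans (∈⇒≤-sum-map f x∈) (m≤n+m _ _)

  -- A `y` among the first `k` letters would break the run of `z`, so the cut must come no later
  -- than the end of `xs`.
  take-++-replicate : ∀ k (xs : List A) {y z ys} → y ≢ z →
                      take k (xs ++ y ∷ ys) ≡ replicate k z → k ≤ length xs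
  take-++-replicate zero    xs       y≢z eq = z≤n
  take-++-replicate (suc k) []       y≢z eq = contradiction (∷-injectiveˡ eq) y≢z
  take-++-replicate (suc k) (x ∷ xs) y≢z eq = s≤s (take-++-replicate k xs y≢z (proj₂ (∷-injective eq)))

  take-replicate⇒≤ : ∀ k (xs : List A) {z} → take k xs ≡ replicate k z → k ≤ length xs
  take-replicate⇒≤ k xs eq =
    m⊓n≡m⇒m≤n (trans (sym (length-take k xs)) (trans (cong length eq) (length-replicate k)))

  m≤m^n : ∀ m n .{{_ : NonZero m}} .{{_ : NonZero n}} → m ≤ m ^ n
  m≤m^n m (suc n) = m≤m*n m (m ^ n) {{m^n≢0 m n}}

  ^2-distrib-* : ∀ m n → (m * n) ^ 2 ≡ m ^ 2 * n ^ 2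
  ^2-distrib-* m n rewrite *-identityʳ (m * n) | *-identityʳ m | *-identityʳ n =
    [m*n]*[o*p]≡[m*o]*[n*p] m n m n

word : ℕ → Word
word k = 0 ∷ 0 ∷ replicate k 1

length-word : ∀ k → length (word k) ≡ 2 + k
length-word k = cong (2 +_) (length-replicate k)

module _ (L : LSystem) where

  -- Brings every derived letter under the identity condition on `τ`, which is imposed on `Σ L`
  -- only.
  derive-closed : All (_∈ Σ L) (derive L)
  derive-closed = closed (d L)
    where
    closed : ∀ e → All (_∈ Σ L) (fold (s L) (concatMap (φ L)) e)
    closed zero    = s-closed L
    closed (suc e) = concat⁺ (map⁺ (All.map (φ-closed L) (closed e)))

  length-φ≤size : ∀ {a} → a ∈ Σ L → length (φ L a) ≤ size L
  length-φ≤size a∈ =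
    ≤-trans (∈⇒≤-sum-map _ a∈)
      (≤-trans (m≤m+n _ (length (s L)))
        (≤-trans (m≤m+n _ (length (Σ L))) (m≤m+n _ 2)))

-- Each iterate begins with `a`, and the image of that letter is `f a`, so the next iterate begins
-- with all of `f a`.
prolongable-prefix : ∀ (f : ℕ → Word) {a x} → f a ≡ a ∷ x →
                     ∀ e → ∃[ r ] fold [ a ] (concatMap f) (suc e) ≡ a ∷ x ++ r
prolongable-prefix f fa zero    = [] , cong (_++ []) fa
prolongable-prefix f {a} {x} fa (suc e) with prolongable-prefix f fa e
... | r , eq rewrite eq | fa = concatMap f (x ++ r) , refl

iterate-word⇒long : ∀ (f : ℕ → Word) {a x} → f a ≡ a ∷ x → x ≢ [] → ∀ k e →
                    take (2 + k) (fold [ a ] (concatMap f) e) ≡ word k → 2 + k ≤ length (f a)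
iterate-word⇒long f {x = []}    fa x≢[] k e eq = contradiction refl x≢[]
-- The axiom is a single letter, while `word k` has at least two.
iterate-word⇒long f {x = _ ∷ _} fa x≢[] k zero ()
iterate-word⇒long f {x = b ∷ x} fa x≢[] k (suc zero) eq
  rewrite fa | ++-identityʳ x =
  s≤s (s≤s (take-replicate⇒≤ k x (proj₂ (∷-injective (proj₂ (∷-injective eq))))))
iterate-word⇒long f {x = b ∷ x} fa x≢[] k (suc (suc e)) eq
  with prolongable-prefix f fa e
... | r , prefix rewrite prefix | fa
  with refl , eq′ ← ∷-injective eq
  with refl , eq″ ← ∷-injective eq′
  -- The first two letters have forced `a` and `b` to be 0, so `f b` is `f a`. Expanding it exposes
  -- its initial 0 directly after `x`, inside what should be a run of 1s.
  rewrite fa = s≤s (s≤s (take-++-replicate k x (λ ()) eq″))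

pure-size≥length : ∀ {K} k L → PureProlongableFor K (word k) L → length (word k) ≤ size L
pure-size≥length k L ((_ , (a , x , s≡ , φa , x≢[]) , (n≡ , gen)) , pure) =
  ≤-trans (≤-reflexive (length-word k))
    (≤-trans (iterate-word⇒long (φ L) φa x≢[] k (d L) eq)
      (length-φ≤size L (All.head (subst (All (_∈ Σ L)) s≡ (s-closed L)))))
  where
  eq : take (2 + k) (fold [ a ] (concatMap (φ L)) (d L)) ≡ word k
  eq rewrite sym s≡ | sym (length-word k) | n≡ =
    trans (cong (take (n L)) (sym (map-id-local (All.map pure (derive-closed L))))) gen

-- At each step 0 emits a fresh 2 and the previous 2 turns into 1, so the word grows by exactly one
-- letter, and the rules stay the same for every `k`.
rule : ℕ → Word
rule 0 = 0 ∷ 2 ∷ []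
rule _ = 1 ∷ []

code : ℕ → ℕ
code 2 = 0
code a = a

coded : ℕ → LSystem
coded k = record
  { Σ            = 0 ∷ 1 ∷ 2 ∷ []
  ; Σ-unique     = ((λ ()) ∷ (λ ()) ∷ []) ∷ ((λ ()) ∷ []) ∷ [] ∷ []
  ; φ            = rule
  ; φ-closed     = λ { (here refl)                 → here refl ∷ there (there (here refl)) ∷ []
                     ; (there (here refl))         → there (here refl) ∷ []
                     ; (there (there (here refl))) → there (here refl) ∷ [] }
  ; φ-nonerasing = λ { {zero} _ → s≤s z≤n ; {suc _} _ → s≤s z≤n }
  ; τ            = code
  ; τ-closed     = λ { (here refl)                 → here refl
                     ; (there (here refl))         → there (here refl)
                     ; (there (there (here refl))) → here refl }
  ; s            = [ 0 ]
  ; s-closed     = here refl ∷ []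
  ; s-nonempty   = λ ()
  -- One step produces `0 2`; each of the other `k` steps adds one 1, giving length exactly `2 + k`.
  ; d            = suc k
  ; n            = 2 + k
  ; n-positive   = s≤s z≤n
  }

rule-ones : ∀ k → concatMap rule (replicate k 1) ≡ replicate k 1
rule-ones zero    = refl
rule-ones (suc k) = cong (1 ∷_) (rule-ones k)

derive-coded : ∀ k → derive (coded k) ≡ 0 ∷ 2 ∷ replicate k 1
derive-coded zero    = refl
derive-coded (suc k) rewrite derive-coded k | rule-ones k = refl

coded-prolongable : ∀ K → .{{NonZero K}} → ∀ k → 1 ≤ k → ProlongableFor K (word k) (coded k)
coded-prolongable K k 1≤k =
    ( ≤-trans (n≤1+n _) (m≤m^n (2 + k) K)
    -- The alphabet has 3 letters, and `1 ≤ k` makes `2 + k` at least 3, which suffices already for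
    -- `K` equal to 1.
    , ≤-trans (s≤s (s≤s 1≤k)) (m≤m^n (2 + k) K))
  , (0 , [ 2 ] , refl , refl , λ ())
  , (length-word k , gen)
  where
  gen : take (2 + k) (map code (derive (coded k))) ≡ word k
  gen rewrite derive-coded k | map-replicate code k 1 =
    take-all (2 + k) (word k) (≤-reflexive (length-word k))

-- The inequality is `m √n ≤ C p` with both sides squared, which avoids real square roots.
lemma7 : ∃[ F ] (IsStringFamily F ×
    (∀ K → .{{NonZero K}} →
    ∃[ C ] ∃[ N ] (1 ≤ C ×
    (∀ w → F w → N ≤ length w →
    ∀ m p → ℓₘ[ K ] w ≔ m → ℓₚ[ K ] w ≔ p →
    m ^ 2 * length w ≤ (C * p) ^ 2))))
lemma7 = (λ w → ∃[ k ] w ≡ word k) , unbounded , λ K → size (coded 0) , 3 , s≤s z≤n , bound K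
  where
  unbounded : IsStringFamily (λ w → ∃[ k ] w ≡ word k)
  unbounded N = word N , (N , refl) , ≤-trans (m≤n+m N 2) (≤-reflexive (sym (length-word N)))

  bound : ∀ K → .{{NonZero K}} → ∀ w → ∃[ k ] w ≡ word k → 3 ≤ length w →
          ∀ m p → ℓₘ[ K ] w ≔ m → ℓₚ[ K ] w ≔ p → m ^ 2 * length w ≤ (size (coded 0) * p) ^ 2
  bound K w (k , refl) 3≤w m p (_ , m-least) ((L , pure , refl) , _) = begin
    m ^ 2 * length w                       ≤⟨ *-mono-≤ (^-monoˡ-≤ 2 m≤c) w≤p ⟩
    size (coded 0) ^ 2 * p                 ≤⟨ *-monoʳ-≤ (size (coded 0) ^ 2) p≤p² ⟩
    size (coded 0) ^ 2 * p ^ 2             ≡⟨ ^2-distrib-* (size (coded 0)) p ⟨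
    (size (coded 0) * p) ^ 2               ∎
    where
    open ≤-Reasoning

    m≤c : m ≤ size (coded 0)
    -- `size (coded k)` evaluates to 10 for every `k`, hence agrees with `size (coded 0)`. The
    -- threshold 3 on the length becomes `1 ≤ k`.
    m≤c = m-least (coded k) (coded-prolongable K k (+-cancelˡ-≤ 2 1 k (subst (3 ≤_) (length-word k) 3≤w)))

    w≤p : length w ≤ p
    w≤p = pure-size≥length {K} k L pure

    -- The linear bound `length w ≤ p` exceeds the required square root; the surplus is given up
    -- here.
    p≤p² : p ≤ p ^ 2
    p≤p² = m≤m^n p 2 {{>-nonZero (≤-trans (s≤s z≤n) w≤p)}}
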